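{- Let $S\ge 3$ and let $n_1,\dots,n_S$ be nonnegative integers. Write $E=E(n_1,\dots,n_S)$ and let $E(n_j\pm1)$ denote $E(n_1,\dots,n_S)$ with only the $j$-th argument replaced by $n_j\pm1$ (a value with a negative argument is $0$). Then $$2(n_2-n_1)E=(n_1+1)E(n_1+1)+n_1E(n_1-1)-(n_2+1)E(n_2+1)-n_2E(n_2-1),$$ $$(n_1+1)E(n_1+1)=n_2E(n_2-1)+\dots+n_SE(n_S-1)+(n_2+\dots+n_S-n_1)E.$$
   Context: For nonnegative integers $n_1,\dots,n_S$, $E(n_1,\dots,n_S)$ denotes the number of block derangements: $S$ players hold $n_1,\dots,n_S$ distinct cards respectively; all $N=n_1+\dots+n_S$ cards are redealt so that player $j$ again receives exactly $n_j$ cards (only which cards each player gets matters); $E$ counts the deals in which no player receives any card he originally held. Equivalently, $E(n_1,\dots,n_S)$ is the coefficient of $x_1^{n_1}\cdots x_S^{n_S}$ in $\prod_{j=1}^S(x_1+\dots+x_S-x_j)^{n_j}$. By convention $E(0,\dots,0)=1$. -}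

module Defs where

open import Data.Fin.Base using (Fin)
open import Data.Fin.Properties using (_≟_; all?)
open import Data.Integer.Properties using (+-0-commutativeMonoid)
open import Data.List.Base using (List; []; _∷_; allFin; cartesianProductWith; concatMap; filter; length; lookup; replicate)
open import Data.Nat.Base using (ℕ; zero; suc; pred)
import Data.Nat.Properties as ℕ
open import Data.Product.Base using (_×_)
open import Data.Vec.Base as Vec using (Vec)
open import Data.Vec.Functional using (Vector; updateAt)
open import Relation.Binary.PropositionalEquality using (_≡_; _≢_)
open import Relation.Nullary.Decidable using (Dec; ¬?; _×-dec_)

open import Algebra.Properties.CommutativeMonoid.Sum +-0-commutativeMonoid public using (sum)

private
  variable
    S : ℕ

-- The N = n₁ + ⋯ + n_S distinct cards are the positions of this list; the
-- entry at a position is the player who originally holds that card.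
owners : Vector ℕ S → List (Fin S)
owners n = concatMap (λ j → replicate (n j) j) (allFin _)

Card : Vector ℕ S → Set
Card n = Fin (length (owners n))

owner : (n : Vector ℕ S) → Card n → Fin S
owner n = lookup (owners n)

-- Only which cards each player gets matters, so a redistribution of the cards
-- is determined by the recipient of each card.
Redistribution : Vector ℕ S → Set
Redistribution {S} n = Vec (Fin S) (length (owners n))

recipient : (n : Vector ℕ S) → Redistribution n → Card n → Fin S
recipient _ = Vec.lookup

IsDeal : (n : Vector ℕ S) → Redistribution n → Set
IsDeal n d = ∀ j → Vec.count (j ≟_) d ≡ n j

IsBlockDerangement : (n : Vector ℕ S) → Redistribution n → Set
IsBlockDerangement n d = IsDeal n d × (∀ c → recipient n d c ≢ owner n c)

isBlockDerangement? : (n : Vector ℕ S) (d : Redistribution n) → Dec (IsBlockDerangement n d)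
isBlockDerangement? n d =
  all? (λ j → Vec.count (j ≟_) d ℕ.≟ n j) ×-dec
  all? (λ c → ¬? (recipient n d c ≟ owner n c))

-- Every vector of length N over Fin S, each exactly once.
allVecs : ∀ S N → List (Vec (Fin S) N)
allVecs S zero    = Vec.[] ∷ []
allVecs S (suc N) = cartesianProductWith Vec._∷_ (allFin S) (allVecs S N)

E : Vector ℕ S → ℕ
E n = length (filter (isBlockDerangement? n) (allVecs _ _))

-- E with only the j-th argument replaced by n_j + 1.
E⁺ : Vector ℕ S → Fin S → ℕ
E⁺ n j = E (updateAt n j suc)

-- E with only the j-th argument replaced by n_j - 1; a value with a negative
-- argument is 0.
E⁻ : Vector ℕ S → Fin S → ℕ
E⁻ n j with n j
... | zero  = 0
... | suc _ = E (updateAt n j pred)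

{-# OPTIONS --safe #-}
module Submission where

-- E n is the coefficient of x^n in P_n = ∏ⱼ (σ - x_j)^{n_j}, where σ = Σⱼ x_j.
-- Since ∂(σ - x_j)/∂x_i is 1 for j ≠ i and 0 for j = i, comparing coefficients
-- in ∂P/∂x_i for P = (σ - x_i) P_n and for P = P_n gives
--   (n_i + 1) E(n_i + 1) = Σ_{j≠i} n_j [x^n] (σ - x_i) P_{n-e_j},
--   n_i E                = Σ_{j≠i} n_j [x^n] x_i P_{n-e_j}.
-- In the sum of the two lines σ - x_i + x_i = (σ - x_j) + x_j, so that
--   (n_i + 1) E(n_i + 1) + n_i E = Σ_{j≠i} n_j (E + E(n_j - 1)).
-- This is the second identity; adding the missing term j = i makes the right
-- side independent of i, and the first identity compares i = 1 with i = 2.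

open import Defs
open import Data.Bool.Base using (true; false; if_then_else_)
open import Data.Fin.Base using (Fin; zero; suc)
open import Data.Fin.Properties using (_≟_; all?)
open import Data.Integer.Base using (ℤ; +_; _+_; _-_; _*_)
import Data.Integer.Properties as ℤ
import Data.Integer.Tactic.RingSolver as ℤSolver
open import Data.List.Base using (List; []; _∷_; _++_; allFin; cartesianProductWith; concatMap; filter; length; lookup; map; removeAt; replicate; tabulate)
open import Data.List.Membership.Propositional using (_∈_)
open import Data.List.Membership.Propositional.Properties using (∈-allFin)
open import Data.List.Properties using (concatMap-cong; filter-++; filter-≐; filter-none; length-++)
open import Data.List.Relation.Binary.Permutation.Propositional using (_↭_; ↭-refl; ↭-reflexive; ↭-sym; ↭-trans; prep; swap; trans; refl)
open import Data.List.Relation.Binary.Permutation.Propositional.Properties using (drop-∷; ++⁺ˡ) renaming (shift to ↭-shift)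
open import Data.List.Relation.Unary.All as All using (All; []; _∷_)
open import Data.List.Relation.Unary.Any using (here; there)
open import Data.List.Relation.Unary.AllPairs using (_∷_)
open import Data.List.Relation.Unary.Unique.Propositional using (Unique)
open import Data.List.Relation.Unary.Unique.Propositional.Properties using (allFin⁺)
open import Data.Nat.Base as ℕ using (ℕ; zero; suc; pred)
import Data.Nat.Properties as ℕ
import Data.Nat.Tactic.RingSolver as ℕSolver
open import Data.Product.Base using (_×_; _,_; proj₁)
open import Data.Vec.Base as Vec using (Vec)
open import Data.Vec.Functional using (Vector; updateAt)
open import Data.Vec.Functional.Properties using (updateAt-updates; updateAt-minimal; updateAt-commutes; updateAt-updateAt; updateAt-id-local)
open import Function.Base using (_∘_; case_of_; id)
open import Function.Bundles using (_⇔_; mk⇔)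
open import Relation.Binary.PropositionalEquality as ≡ using (_≡_; _≢_; _≗_; cong; cong₂; sym; module ≡-Reasoning)
open import Relation.Nullary.Decidable using (does; yes; no; ¬?; _×-dec_; dec-false; does-⇔)
open import Relation.Nullary.Negation using (¬_; contradiction)
open import Relation.Unary using (Decidable; _≐_)

open import Algebra.Properties.Semiring.Sum ℕ.+-*-semiring
  using (sum-cong-≗; sum-replicate-zero; ∑-distrib-+; ∑-comm; *-distribˡ-sum; *-distribʳ-sum)
  renaming (sum to ∑)
import Algebra.Properties.CommutativeMonoid.Sum ℤ.+-0-commutativeMonoid as ℤSum

private
  variable
    S : ℕ
    A B C : Set

-- Kronecker delta and finite sums

δ δᶜ : Fin S → Fin S → ℕ
δ  i j = if does (i ≟ j) then 1 else 0
δᶜ i j = if does (i ≟ j) then 0 else 1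

δᶜ-irrefl : (i : Fin S) → δᶜ i i ≡ 0
δᶜ-irrefl i with i ≟ i
... | yes _  = ≡.refl
... | no i≢i = contradiction ≡.refl i≢i

δᶜ-sym : (i j : Fin S) → δᶜ i j ≡ δᶜ j i
δᶜ-sym i j with i ≟ j | j ≟ i
... | yes _   | yes _   = ≡.refl
... | no _    | no _    = ≡.refl
... | yes i≡j | no j≢i  = contradiction (sym i≡j) j≢i
... | no i≢j  | yes j≡i = contradiction (sym j≡i) i≢j

∑-δ : (i : Fin S) (f : Vector ℕ S) → ∑ (λ k → δ i k ℕ.* f k) ≡ f i
∑-δ {S = suc S} zero f = ≡.trans (cong₂ ℕ._+_ (ℕ.*-identityˡ _) (sum-replicate-zero S)) (ℕ.+-identityʳ _)
∑-δ (suc i) f = ∑-δ i (f ∘ suc)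

-- The weights `δᶜ i` and `δ i` add up to 1. The omitted term stands on the left because subtraction
-- on `ℕ` is truncated.
∑-δᶜ : (i : Fin S) (f : Vector ℕ S) → ∑ (λ k → δᶜ i k ℕ.* f k) ℕ.+ f i ≡ ∑ f
∑-δᶜ i f = begin
  ∑ (λ k → δᶜ i k ℕ.* f k) ℕ.+ f i                        ≡⟨ cong (∑ (λ k → δᶜ i k ℕ.* f k) ℕ.+_) (∑-δ i f) ⟨
  ∑ (λ k → δᶜ i k ℕ.* f k) ℕ.+ ∑ (λ k → δ i k ℕ.* f k)    ≡⟨ ∑-distrib-+ (λ k → δᶜ i k ℕ.* f k) (λ k → δ i k ℕ.* f k) ⟨
  ∑ (λ k → δᶜ i k ℕ.* f k ℕ.+ δ i k ℕ.* f k)              ≡⟨ sum-cong-≗ term ⟩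
  ∑ f                                                     ∎
  where
  open ≡-Reasoning
  term : ∀ k → δᶜ i k ℕ.* f k ℕ.+ δ i k ℕ.* f k ≡ f k
  term k with does (i ≟ k)
  ... | true  = ℕ.*-identityˡ _
  ... | false = ≡.trans (ℕ.+-identityʳ _) (ℕ.*-identityˡ _)

-- Multiplication by a variable

-- Since `pred` fixes 0, lowering a zero exponent would read off a wrong coefficient. `guard`
-- returns 0 in that case, in agreement with the convention built into `E⁻`.
guard : ℕ → ℕ → ℕ
guard zero    _ = 0
guard (suc _) v = v

guard-∑ : ∀ a (f : Vector ℕ S) → guard a (∑ f) ≡ ∑ (λ k → guard a (f k))
guard-∑ {S = S} zero f = sym (sum-replicate-zero S)
guard-∑ (suc _) f = ≡.refl

guard-* : ∀ a c v → guard a (c ℕ.* v) ≡ c ℕ.* guard a v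
guard-* zero    c v = sym (ℕ.*-zeroʳ c)
guard-* (suc _) c v = ≡.refl

guard-comm : ∀ a b v → guard a (guard b v) ≡ guard b (guard a v)
guard-comm zero    zero    v = ≡.refl
guard-comm zero    (suc _) v = ≡.refl
guard-comm (suc _) b       v = ≡.refl

guard-∑* : ∀ a (c f : Vector ℕ S) → guard a (∑ (λ k → c k ℕ.* f k)) ≡ ∑ (λ k → c k ℕ.* guard a (f k))
guard-∑* a c f = ≡.trans (guard-∑ a (λ k → c k ℕ.* f k)) (sum-cong-≗ λ k → guard-* a (c k) (f k))

-- If p m is the coefficient of x^m in a polynomial, shift k p m is the one in
-- its product with x_k.
shift : Fin S → (Vector ℕ S → ℕ) → Vector ℕ S → ℕ
shift k p m = guard (m k) (p (updateAt m k pred))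

-- Exponent vectors are functions, and the laws for their updates hold only pointwise, so
-- coefficients must be shown to respect pointwise equality.
Extensional : (Vector ℕ S → ℕ) → Set
Extensional p = ∀ {m m′} → m ≗ m′ → p m ≡ p m′

updateAt-≗ : ∀ k (f : ℕ → ℕ) {m m′ : Vector ℕ S} → m ≗ m′ → updateAt m k f ≗ updateAt m′ k f
updateAt-≗ zero    f m≗m′ zero    = cong f (m≗m′ zero)
updateAt-≗ zero    f m≗m′ (suc j) = m≗m′ (suc j)
updateAt-≗ (suc k) f m≗m′ zero    = m≗m′ zero
updateAt-≗ (suc k) f m≗m′ (suc j) = updateAt-≗ k f (m≗m′ ∘ suc) j

updateAt-suc-pred : ∀ k (m : Vector ℕ S) {p} → m k ≡ suc p → updateAt (updateAt m k pred) k suc ≗ m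
updateAt-suc-pred k m mk≡ j =
  ≡.trans (updateAt-updateAt k m j)
          (updateAt-id-local k m (≡.trans (cong (λ a → suc (pred a)) mk≡) (sym mk≡)) j)

updateAt-pred-suc : ∀ k (m : Vector ℕ S) → updateAt (updateAt m k suc) k pred ≗ m
updateAt-pred-suc k m j = ≡.trans (updateAt-updateAt k m j) (updateAt-id-local k m ≡.refl j)

shift-ext : ∀ k {p : Vector ℕ S → ℕ} → Extensional p → Extensional (shift k p)
shift-ext k ext m≗m′ = cong₂ guard (m≗m′ k) (ext (updateAt-≗ k pred m≗m′))

shift-comm : ∀ k l {p : Vector ℕ S → ℕ} → Extensional p →
             ∀ m → shift k (shift l p) m ≡ shift l (shift k p) m
shift-comm k l {p} ext m with k ≟ l
... | yes ≡.refl = ≡.refl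
... | no k≢l = begin
  guard (m k) (guard (updateAt m k pred l) (p (updateAt (updateAt m k pred) l pred)))
    ≡⟨ cong (guard (m k)) (cong₂ guard (updateAt-minimal l k m (k≢l ∘ sym))
         (ext (updateAt-commutes l k (k≢l ∘ sym) m))) ⟩
  guard (m k) (guard (m l) (p (updateAt (updateAt m l pred) k pred)))
    ≡⟨ guard-comm (m k) (m l) _ ⟩
  guard (m l) (guard (m k) (p (updateAt (updateAt m l pred) k pred)))
    ≡⟨ cong (λ a → guard (m l) (guard a (p (updateAt (updateAt m l pred) k pred)))) (updateAt-minimal k l m k≢l) ⟨
  guard (m l) (guard (updateAt m l pred k) (p (updateAt (updateAt m l pred) k pred)))
    ∎
  where open ≡-Reasoning

-- Coefficients of products of the linear forms σ - x_j

-- coeff w m is the coefficient of x^m in the product of σ - x_j over the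
-- entries j of w, where σ is the sum of all the variables.
coeff : List (Fin S) → Vector ℕ S → ℕ
coeff []      m = if does (all? (λ j → 0 ℕ.≟ m j)) then 1 else 0
coeff (x ∷ w) m = ∑ λ k → δᶜ x k ℕ.* shift k (coeff w) m

coeff-ext : (w : List (Fin S)) → Extensional (coeff w)
coeff-ext [] {m} {m′} m≗m′ = cong (if_then 1 else 0) (does-⇔ 0≗m⇔0≗m′ (all? λ j → 0 ℕ.≟ m j) (all? λ j → 0 ℕ.≟ m′ j))
  where
  0≗m⇔0≗m′ : (∀ j → 0 ≡ m j) ⇔ (∀ j → 0 ≡ m′ j)
  0≗m⇔0≗m′ = mk⇔ (λ 0≗m j → ≡.trans (0≗m j) (m≗m′ j)) (λ 0≗m′ j → ≡.trans (0≗m′ j) (sym (m≗m′ j)))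
coeff-ext (x ∷ w) m≗m′ = sum-cong-≗ λ k → cong (δᶜ x k ℕ.*_) (shift-ext k (coeff-ext w) m≗m′)

-- This is (σ - x_x) + x_x = σ. The right side does not mention `x`, which later allows one factor
-- to be exchanged for another.
coeff-∷-+ : ∀ x (w : List (Fin S)) m →
            coeff (x ∷ w) m ℕ.+ shift x (coeff w) m ≡ ∑ (λ k → shift k (coeff w) m)
coeff-∷-+ x w m = ∑-δᶜ x (λ k → shift k (coeff w) m)

coeff-∷∷ : ∀ x y (w : List (Fin S)) m → coeff (x ∷ y ∷ w) m ≡
           ∑ (λ k → ∑ λ l → δᶜ x k ℕ.* (δᶜ y l ℕ.* shift k (shift l (coeff w)) m))
coeff-∷∷ x y w m = sum-cong-≗ λ k →
  ≡.trans (cong (δᶜ x k ℕ.*_) (guard-∑* (m k) (δᶜ y) (λ l → shift l (coeff w) (updateAt m k pred))))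
          (*-distribˡ-sum (δᶜ x k) (λ l → δᶜ y l ℕ.* shift k (shift l (coeff w)) m))

x*[y*z]≡y*[x*z] : ∀ x y z → x ℕ.* (y ℕ.* z) ≡ y ℕ.* (x ℕ.* z)
x*[y*z]≡y*[x*z] = ℕSolver.solve-∀

-- Both products expand into the same double sum over the monomials chosen from the two factors, up
-- to the order of summation and of the two shifts.
coeff-swap : ∀ x y (w : List (Fin S)) m → coeff (x ∷ y ∷ w) m ≡ coeff (y ∷ x ∷ w) m
coeff-swap x y w m = begin
  coeff (x ∷ y ∷ w) m
    ≡⟨ coeff-∷∷ x y w m ⟩
  ∑ (λ k → ∑ λ l → δᶜ x k ℕ.* (δᶜ y l ℕ.* shift k (shift l (coeff w)) m))
    ≡⟨ ∑-comm (λ k l → δᶜ x k ℕ.* (δᶜ y l ℕ.* shift k (shift l (coeff w)) m)) ⟩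
  ∑ (λ l → ∑ λ k → δᶜ x k ℕ.* (δᶜ y l ℕ.* shift k (shift l (coeff w)) m))
    ≡⟨ (sum-cong-≗ λ l → sum-cong-≗ λ k → ≡.trans (x*[y*z]≡y*[x*z] (δᶜ x k) (δᶜ y l) _)
         (cong (λ v → δᶜ y l ℕ.* (δᶜ x k ℕ.* v)) (shift-comm k l (coeff-ext w) m))) ⟩
  ∑ (λ l → ∑ λ k → δᶜ y l ℕ.* (δᶜ x k ℕ.* shift l (shift k (coeff w)) m))
    ≡⟨ coeff-∷∷ y x w m ⟨
  coeff (y ∷ x ∷ w) m ∎
  where open ≡-Reasoning

coeff-∷-cong : ∀ x (w w′ : List (Fin S)) → coeff w ≗ coeff w′ → coeff (x ∷ w) ≗ coeff (x ∷ w′)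
coeff-∷-cong x w w′ w≗w′ m = sum-cong-≗ λ k → cong (λ v → δᶜ x k ℕ.* guard (m k) v) (w≗w′ (updateAt m k pred))

-- Changing one argument of `n` inserts or deletes a card in the middle of `owners n`, while `coeff`
-- peels factors off the front. Commutativity of the product bridges the two.
coeff-↭ : {w w′ : List (Fin S)} → w ↭ w′ → coeff w ≗ coeff w′
coeff-↭ refl m = ≡.refl
coeff-↭ (prep {xs} {ys} x p) m = coeff-∷-cong x xs ys (coeff-↭ p) m
coeff-↭ (swap {xs} {ys} x y p) m = ≡.trans
  (coeff-swap x y xs m)
  (coeff-∷-cong y (x ∷ xs) (x ∷ ys) (coeff-∷-cong x xs ys (coeff-↭ p)) m)
coeff-↭ (trans p q) m = ≡.trans (coeff-↭ p m) (coeff-↭ q m)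

-- The coefficient of x^m in ∂/∂x_i of the product, expanded by the Leibniz rule.
deriv : Fin S → List (Fin S) → Vector ℕ S → ℕ
deriv i w m = ∑ λ c → δᶜ i (lookup w c) ℕ.* coeff (removeAt w c) m

shift-deriv : ∀ k i (w : List (Fin S)) m →
              shift k (deriv i w) m ≡ ∑ (λ c → δᶜ i (lookup w c) ℕ.* shift k (coeff (removeAt w c)) m)
shift-deriv k i w m =
  guard-∑* (m k) (λ c → δᶜ i (lookup w c)) (λ c → coeff (removeAt w c) (updateAt m k pred))

-- Removing the head leaves the product over `w`. Every other removal keeps the factor of `x`, which
-- is pulled out by interchanging the sums over cards and over variables.
deriv-∷ : ∀ i x (w : List (Fin S)) m →
          deriv i (x ∷ w) m ≡ δᶜ i x ℕ.* coeff w m ℕ.+ ∑ (λ k → δᶜ x k ℕ.* shift k (deriv i w) m)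
deriv-∷ i x w m = cong (δᶜ i x ℕ.* coeff w m ℕ.+_) (begin
  ∑ (λ c → δᶜ i (lookup w c) ℕ.* ∑ (λ k → δᶜ x k ℕ.* shift k (coeff (removeAt w c)) m))
    ≡⟨ (sum-cong-≗ λ c → ≡.trans
         (*-distribˡ-sum (δᶜ i (lookup w c)) (λ k → δᶜ x k ℕ.* shift k (coeff (removeAt w c)) m))
         (sum-cong-≗ λ k → x*[y*z]≡y*[x*z] (δᶜ i (lookup w c)) (δᶜ x k) _)) ⟩
  ∑ (λ c → ∑ λ k → δᶜ x k ℕ.* (δᶜ i (lookup w c) ℕ.* shift k (coeff (removeAt w c)) m))
    ≡⟨ ∑-comm (λ c k → δᶜ x k ℕ.* (δᶜ i (lookup w c) ℕ.* shift k (coeff (removeAt w c)) m)) ⟩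
  ∑ (λ k → ∑ λ c → δᶜ x k ℕ.* (δᶜ i (lookup w c) ℕ.* shift k (coeff (removeAt w c)) m))
    ≡⟨ (sum-cong-≗ λ k → ≡.trans
         (sym (*-distribˡ-sum (δᶜ x k) (λ c → δᶜ i (lookup w c) ℕ.* shift k (coeff (removeAt w c)) m)))
         (cong (δᶜ x k ℕ.*_) (sym (shift-deriv k i w m)))) ⟩
  ∑ (λ k → δᶜ x k ℕ.* shift k (deriv i w) m) ∎)
  where open ≡-Reasoning

-- For positive `m i` this is the hypothesis at the exponent lowered in `i`; for `m i` zero both
-- sides vanish. It is kept apart from `euler` because the induction in `coeff-deriv` already needs
-- it for the tail.
coeff-deriv⇒euler : ∀ i (w : List (Fin S)) →
             (∀ m → suc (m i) ℕ.* coeff w (updateAt m i suc) ≡ deriv i w m) →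
             ∀ m → m i ℕ.* coeff w m ≡ shift i (deriv i w) m
coeff-deriv⇒euler i w h m with m i in mi≡
... | zero  = ≡.refl
... | suc p = begin
  suc p ℕ.* coeff w m
    ≡⟨ cong₂ (λ a v → suc a ℕ.* v)
         (sym (≡.trans (updateAt-updates i m) (cong pred mi≡)))
         (coeff-ext w (λ j → sym (updateAt-suc-pred i m mi≡ j))) ⟩
  suc (updateAt m i pred i) ℕ.* coeff w (updateAt (updateAt m i pred) i suc)
    ≡⟨ h (updateAt m i pred) ⟩
  deriv i w (updateAt m i pred) ∎
  where open ≡-Reasoning

-- Differentiating x^m coefficientwise agrees with the Leibniz expansion. The proof is by induction
-- on the number of factors, where each variable of the head factor is commuted past ∂/∂x_i.
coeff-deriv : ∀ i (w : List (Fin S)) m → suc (m i) ℕ.* coeff w (updateAt m i suc) ≡ deriv i w m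
coeff-deriv i [] m = ≡.trans
  (cong (λ b → suc (m i) ℕ.* (if b then 1 else 0)) (dec-false (all? λ j → 0 ℕ.≟ updateAt m i suc j) 0≭))
  (ℕ.*-zeroʳ (suc (m i)))
  where
  0≭ : ¬ (∀ j → 0 ≡ updateAt m i suc j)
  0≭ 0≗ = contradiction (≡.trans (0≗ i) (updateAt-updates i m)) (λ ())
coeff-deriv i (x ∷ w) m = begin
  suc (m i) ℕ.* ∑ (λ k → δᶜ x k ℕ.* shift k (coeff w) (updateAt m i suc))
    ≡⟨ *-distribˡ-sum (suc (m i)) (λ k → δᶜ x k ℕ.* shift k (coeff w) (updateAt m i suc)) ⟩
  ∑ (λ k → suc (m i) ℕ.* (δᶜ x k ℕ.* shift k (coeff w) (updateAt m i suc)))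
    ≡⟨ (sum-cong-≗ λ k → ≡.trans (x*[y*z]≡y*[x*z] (suc (m i)) (δᶜ x k) _)
         (≡.trans (cong (δᶜ x k ℕ.*_) (term k)) (distrib (δᶜ x k) (δ i k) _ _))) ⟩
  ∑ (λ k → δ i k ℕ.* (δᶜ x k ℕ.* coeff w m) ℕ.+ δᶜ x k ℕ.* shift k (deriv i w) m)
    ≡⟨ ∑-distrib-+ (λ k → δ i k ℕ.* (δᶜ x k ℕ.* coeff w m)) (λ k → δᶜ x k ℕ.* shift k (deriv i w) m) ⟩
  ∑ (λ k → δ i k ℕ.* (δᶜ x k ℕ.* coeff w m)) ℕ.+ ∑ (λ k → δᶜ x k ℕ.* shift k (deriv i w) m)
    ≡⟨ cong (ℕ._+ ∑ (λ k → δᶜ x k ℕ.* shift k (deriv i w) m))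
         (≡.trans (∑-δ i (λ k → δᶜ x k ℕ.* coeff w m)) (cong (ℕ._* coeff w m) (δᶜ-sym x i))) ⟩
  δᶜ i x ℕ.* coeff w m ℕ.+ ∑ (λ k → δᶜ x k ℕ.* shift k (deriv i w) m)
    ≡⟨ deriv-∷ i x w m ⟨
  deriv i (x ∷ w) m ∎
  where
  open ≡-Reasoning
  distrib : ∀ a b c d → a ℕ.* (b ℕ.* c ℕ.+ d) ≡ b ℕ.* (a ℕ.* c) ℕ.+ a ℕ.* d
  distrib = ℕSolver.solve-∀

  -- For Q the product over `w`, this is the product rule ∂(x_k Q)/∂x_i = δ_ik Q + x_k ∂Q/∂x_i.
  term : ∀ k → suc (m i) ℕ.* shift k (coeff w) (updateAt m i suc) ≡
               δ i k ℕ.* coeff w m ℕ.+ shift k (deriv i w) m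
  term k with i ≟ k
  ... | yes ≡.refl = begin
    suc (m i) ℕ.* guard (updateAt m i suc i) (coeff w (updateAt (updateAt m i suc) i pred))
      ≡⟨ cong (suc (m i) ℕ.*_) (cong₂ guard (updateAt-updates i m) (coeff-ext w (updateAt-pred-suc i m))) ⟩
    -- Of the `suc (m i)` copies, one is the Kronecker delta term and the other `m i` make up x_i
    -- ∂Q/∂x_i.
    coeff w m ℕ.+ m i ℕ.* coeff w m
      ≡⟨ cong₂ ℕ._+_ (sym (ℕ.*-identityˡ _)) (coeff-deriv⇒euler i w (coeff-deriv i w) m) ⟩
    1 ℕ.* coeff w m ℕ.+ shift i (deriv i w) m ∎
  ... | no i≢k = begin
    suc (m i) ℕ.* guard (updateAt m i suc k) (coeff w (updateAt (updateAt m i suc) k pred))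
      ≡⟨ cong (suc (m i) ℕ.*_) (cong₂ guard (updateAt-minimal k i m (i≢k ∘ sym))
           (coeff-ext w (updateAt-commutes k i (i≢k ∘ sym) m))) ⟩
    suc (m i) ℕ.* guard (m k) (coeff w (updateAt (updateAt m k pred) i suc))
      ≡⟨ guard-* (m k) (suc (m i)) _ ⟨
    guard (m k) (suc (m i) ℕ.* coeff w (updateAt (updateAt m k pred) i suc))
      ≡⟨ cong (λ a → guard (m k) (suc a ℕ.* coeff w (updateAt (updateAt m k pred) i suc)))
           (updateAt-minimal i k m i≢k) ⟨
    guard (m k) (suc (updateAt m k pred i) ℕ.* coeff w (updateAt (updateAt m k pred) i suc))
      ≡⟨ cong (guard (m k)) (coeff-deriv i w (updateAt m k pred)) ⟩
    shift k (deriv i w) m ∎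

-- The operator x_i ∂/∂x_i multiplies x^m by its exponent `m i`.
euler : ∀ i (w : List (Fin S)) m → m i ℕ.* coeff w m ≡ shift i (deriv i w) m
euler i w = coeff-deriv⇒euler i w (coeff-deriv i w)

-- Block derangements are counted by a coefficient

-- Decoupling the owners `w` from the prescribed hand sizes `m` lets both shrink independently in an
-- induction over the cards. At `owners n` and `n` it unfolds to `IsBlockDerangement n`.
Deranges : (w : List (Fin S)) → Vector ℕ S → Vec (Fin S) (length w) → Set
Deranges w m d = (∀ j → Vec.count (j ≟_) d ≡ m j) × (∀ c → Vec.lookup d c ≢ lookup w c)

deranges? : (w : List (Fin S)) (m : Vector ℕ S) → Decidable (Deranges w m)
deranges? w m d =
  all? (λ j → Vec.count (j ≟_) d ℕ.≟ m j) ×-dec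
  all? (λ c → ¬? (Vec.lookup d c ≟ lookup w c))

length-filter-map : {P : B → Set} (P? : Decidable P) (f : A → B) (xs : List A) →
                    length (filter P? (map f xs)) ≡ length (filter (P? ∘ f) xs)
length-filter-map P? f []       = ≡.refl
length-filter-map P? f (x ∷ xs) with does (P? (f x))
... | true  = cong suc (length-filter-map P? f xs)
... | false = length-filter-map P? f xs

-- Stated for `tabulate g` instead of `allFin`, so that the induction can pass to `g ∘ suc`.
length-filter-cartesianProductWith :
  {P : C → Set} (P? : Decidable P) (f : A → B → C) {t : ℕ} (g : Fin t → A) (ys : List B) →
  length (filter P? (cartesianProductWith f (tabulate g) ys)) ≡ ∑ (λ k → length (filter (P? ∘ f (g k)) ys))
length-filter-cartesianProductWith P? f {zero}  g ys = ≡.refl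
length-filter-cartesianProductWith P? f {suc t} g ys = begin
  length (filter P? (map (f (g zero)) ys ++ rest))
    ≡⟨ cong length (filter-++ P? (map (f (g zero)) ys) rest) ⟩
  length (filter P? (map (f (g zero)) ys) ++ filter P? rest)
    ≡⟨ length-++ (filter P? (map (f (g zero)) ys)) ⟩
  length (filter P? (map (f (g zero)) ys)) ℕ.+ length (filter P? rest)
    ≡⟨ cong₂ ℕ._+_ (length-filter-map P? (f (g zero)) ys)
                   (length-filter-cartesianProductWith P? f (g ∘ suc) ys) ⟩
  ∑ (λ k → length (filter (P? ∘ f (g k)) ys)) ∎
  where
  open ≡-Reasoning
  rest = cartesianProductWith f (tabulate (g ∘ suc)) ys

length-filter-none : {P : A → Set} (P? : Decidable P) → (∀ x → ¬ P x) → ∀ xs → length (filter P? xs) ≡ 0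
length-filter-none P? ¬P xs = cong length (filter-none P? (All.universal ¬P xs))

count-∷-≡ : ∀ k {N} (d : Vec (Fin S) N) → Vec.count (k ≟_) (k Vec.∷ d) ≡ suc (Vec.count (k ≟_) d)
count-∷-≡ k d with k ≟ k
... | yes _  = ≡.refl
... | no k≢k = contradiction ≡.refl k≢k

count-∷-≢ : ∀ {j k} → j ≢ k → ∀ {N} (d : Vec (Fin S) N) → Vec.count (j ≟_) (k Vec.∷ d) ≡ Vec.count (j ≟_) d
count-∷-≢ {j = j} {k} j≢k d with j ≟ k
... | yes j≡k = contradiction j≡k j≢k
... | no _    = ≡.refl

-- Handing the first card to `k` uses up one place in the hand of `k`. The hypothesis `m k ≡ suc p`
-- ensures that `pred` really lowers the count.
Deranges-∷ : ∀ {x k} (w : List (Fin S)) (m : Vector ℕ S) {p} → m k ≡ suc p → x ≢ k →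
             (λ d → Deranges (x ∷ w) m (k Vec.∷ d)) ≐ Deranges w (updateAt m k pred)
Deranges-∷ {x = x} {k} w m {p} mk≡ x≢k = to , from
  where
  pred-m : updateAt m k pred k ≡ p
  pred-m = ≡.trans (updateAt-updates k m) (cong pred mk≡)

  to : ∀ {d} → Deranges (x ∷ w) m (k Vec.∷ d) → Deranges w (updateAt m k pred) d
  to {d} (count≡ , lookup≢) = count′ , lookup≢ ∘ suc
    where
    count′ : ∀ j → Vec.count (j ≟_) d ≡ updateAt m k pred j
    count′ j with j ≟ k
    ... | yes ≡.refl = ℕ.suc-injective (≡.trans (sym (count-∷-≡ k d))
                         (≡.trans (count≡ k) (≡.trans mk≡ (cong suc (sym pred-m)))))
    ... | no j≢k = ≡.trans (sym (count-∷-≢ j≢k d)) (≡.trans (count≡ j) (sym (updateAt-minimal j k m j≢k)))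

  from : ∀ {d} → Deranges w (updateAt m k pred) d → Deranges (x ∷ w) m (k Vec.∷ d)
  from {d} (count≡ , lookup≢) = count′ , λ { zero → x≢k ∘ sym ; (suc c) → lookup≢ c }
    where
    count′ : ∀ j → Vec.count (j ≟_) (k Vec.∷ d) ≡ m j
    count′ j = case j ≟ k of λ where
      (yes ≡.refl) → ≡.trans (count-∷-≡ k d) (≡.trans (cong suc (≡.trans (count≡ k) pred-m)) (sym mk≡))
      (no j≢k)     → ≡.trans (count-∷-≢ j≢k d) (≡.trans (count≡ j) (updateAt-minimal j k m j≢k))

-- Giving the first card, owned by `x`, to a player `k` other than `x` corresponds to choosing the
-- monomial x_k from the factor σ - x_x.
derangements-coeff : ∀ (w : List (Fin S)) m → length (filter (deranges? w m) (allVecs S (length w))) ≡ coeff w m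
derangements-coeff {S} [] m = begin
  length (filter (deranges? [] m) (Vec.[] ∷ []))
    ≡⟨ length-filter-[x] (deranges? [] m) Vec.[] ⟩
  (if does (deranges? [] m Vec.[]) then 1 else 0)
    -- With no cards every count computes to 0 and nothing remains to be deranged, so only the test
    -- for the zero exponent is left.
    ≡⟨ cong (if_then 1 else 0) (does-⇔ (mk⇔ proj₁ (_, λ ())) (deranges? [] m Vec.[]) (all? λ j → 0 ℕ.≟ m j)) ⟩
  coeff [] m ∎
  where
  open ≡-Reasoning
  length-filter-[x] : {P : A → Set} (P? : Decidable P) (x : A) →
                      length (filter P? (x ∷ [])) ≡ (if does (P? x) then 1 else 0)
  length-filter-[x] P? x with does (P? x)
  ... | true  = ≡.refl
  ... | false = ≡.refl
derangements-coeff {S} (x ∷ w) m = ≡.trans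
  (length-filter-cartesianProductWith (deranges? (x ∷ w) m) Vec._∷_ id (allVecs S (length w)))
  (sum-cong-≗ term)
  where
  open ≡-Reasoning
  term : ∀ k → length (filter (deranges? (x ∷ w) m ∘ (k Vec.∷_)) (allVecs S (length w))) ≡
               δᶜ x k ℕ.* shift k (coeff w) m
  term k with x ≟ k
  -- Two kinds of recipient contribute nothing: the owner of the card, and below a player whose hand
  -- is already full.
  ... | yes ≡.refl = length-filter-none (deranges? (x ∷ w) m ∘ (k Vec.∷_))
                       (λ _ (_ , lookup≢) → lookup≢ zero ≡.refl) (allVecs S (length w))
  ... | no x≢k with m k in mk≡
  ...   | zero  = length-filter-none (deranges? (x ∷ w) m ∘ (k Vec.∷_))
                    (λ d (count≡ , _) → contradiction
                      (≡.trans (sym (count-∷-≡ k d)) (≡.trans (count≡ k) mk≡)) λ ())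
                    (allVecs S (length w))
  ...   | suc _ = begin
    length (filter (deranges? (x ∷ w) m ∘ (k Vec.∷_)) (allVecs S (length w)))
      ≡⟨ cong length (filter-≐ (deranges? (x ∷ w) m ∘ (k Vec.∷_)) (deranges? w (updateAt m k pred))
           (Deranges-∷ w m mk≡ x≢k) (allVecs S (length w))) ⟩
    length (filter (deranges? w (updateAt m k pred)) (allVecs S (length w)))
      ≡⟨ derangements-coeff w (updateAt m k pred) ⟩
    coeff w (updateAt m k pred)
      ≡⟨ ℕ.*-identityˡ _ ⟨
    1 ℕ.* coeff w (updateAt m k pred) ∎

E-coeff : (n : Vector ℕ S) → E n ≡ coeff (owners n) n
E-coeff n = derangements-coeff (owners n) n

-- The multiset of owners

concatMap-replicate-suc-∉ : ∀ i (n : Vector ℕ S) {xs} → All (i ≢_) xs →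
  concatMap (λ j → replicate (updateAt n i suc j) j) xs ≡ concatMap (λ j → replicate (n j) j) xs
concatMap-replicate-suc-∉ i n []                    = ≡.refl
concatMap-replicate-suc-∉ i n (_∷_ {x} i≢x i∉xs) =
  cong₂ (λ a ys → replicate a x ++ ys) (updateAt-minimal x i n (i≢x ∘ sym)) (concatMap-replicate-suc-∉ i n i∉xs)

-- By uniqueness `i` has a single block, and only this block grows. The new copy is then moved to
-- the front past the earlier blocks.
concatMap-replicate-suc-∈ : ∀ i (n : Vector ℕ S) {xs} → Unique xs → i ∈ xs →
  concatMap (λ j → replicate (updateAt n i suc j) j) xs ↭ i ∷ concatMap (λ j → replicate (n j) j) xs
concatMap-replicate-suc-∈ i n (i∉xs ∷ _) (here ≡.refl) = ↭-reflexive
  (cong₂ (λ a ys → replicate a i ++ ys) (updateAt-updates i n) (concatMap-replicate-suc-∉ i n i∉xs))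
concatMap-replicate-suc-∈ i n {x ∷ xs} (x∉xs ∷ xs!) (there i∈xs)
  rewrite updateAt-minimal x i {suc} n (All.lookup x∉xs i∈xs) = ↭-trans
    (++⁺ˡ (replicate (n x) x) (concatMap-replicate-suc-∈ i n xs! i∈xs))
    (↭-shift i (replicate (n x) x) (concatMap (λ j → replicate (n j) j) xs))

owners-suc : ∀ i (n : Vector ℕ S) → owners (updateAt n i suc) ↭ i ∷ owners n
owners-suc i n = concatMap-replicate-suc-∈ i n (allFin⁺ _) (∈-allFin i)

owners-pred : ∀ i (n : Vector ℕ S) {p} → n i ≡ suc p → owners n ↭ i ∷ owners (updateAt n i pred)
owners-pred i n ni≡ = ↭-trans
  (↭-reflexive (concatMap-cong (λ j → cong (λ a → replicate a j) (sym (updateAt-suc-pred i n ni≡ j))) (allFin _)))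
  (owners-suc i (updateAt n i pred))

↭-removeAt : (w : List A) (c : Fin (length w)) → w ↭ lookup w c ∷ removeAt w c
↭-removeAt (x ∷ w) zero    = ↭-refl
↭-removeAt (x ∷ w) (suc c) = ↭-trans (prep x (↭-removeAt w c)) (swap x (lookup w c) ↭-refl)

∑-lookup-++ : (h : A → ℕ) (xs ys : List A) →
              ∑ (h ∘ lookup (xs ++ ys)) ≡ ∑ (h ∘ lookup xs) ℕ.+ ∑ (h ∘ lookup ys)
∑-lookup-++ h []       ys = ≡.refl
∑-lookup-++ h (x ∷ xs) ys =
  ≡.trans (cong (h x ℕ.+_) (∑-lookup-++ h xs ys)) (sym (ℕ.+-assoc (h x) _ _))

∑-lookup-replicate : (h : A → ℕ) (t : ℕ) (x : A) → ∑ (h ∘ lookup (replicate t x)) ≡ t ℕ.* h x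
∑-lookup-replicate h zero    x = ≡.refl
∑-lookup-replicate h (suc t) x = cong (h x ℕ.+_) (∑-lookup-replicate h t x)

∑-lookup-concatMap : (h : B → ℕ) (f : A → List B) {t : ℕ} (g : Fin t → A) →
                     ∑ (h ∘ lookup (concatMap f (tabulate g))) ≡ ∑ (λ k → ∑ (h ∘ lookup (f (g k))))
∑-lookup-concatMap h f {zero}  g = ≡.refl
∑-lookup-concatMap h f {suc t} g = ≡.trans
  (∑-lookup-++ h (f (g zero)) (concatMap f (tabulate (g ∘ suc))))
  (cong (∑ (h ∘ lookup (f (g zero))) ℕ.+_) (∑-lookup-concatMap h f (g ∘ suc)))

-- Grouping cards by owner turns the Leibniz sum over cards into a sum over players, which is the
-- source of the coefficients n_j.
∑-owner : (h : Fin S → ℕ) (n : Vector ℕ S) → ∑ (h ∘ owner n) ≡ ∑ (λ j → n j ℕ.* h j)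
∑-owner h n = ≡.trans (∑-lookup-concatMap h (λ j → replicate (n j) j) id)
                      (sum-cong-≗ λ j → ∑-lookup-replicate h (n j) j)

E⁺-coeff : ∀ i (n : Vector ℕ S) → E⁺ n i ≡ coeff (i ∷ owners n) (updateAt n i suc)
E⁺-coeff i n = ≡.trans (E-coeff (updateAt n i suc)) (coeff-↭ (owners-suc i n) (updateAt n i suc))

-- For positive `n i`, cancelling `i` shows that `w` rearranges the owners of the lowered vector.
-- Leaving `w` arbitrary makes this applicable to the list with any one card removed.
E⁻-coeff : ∀ i (n : Vector ℕ S) {w} → owners n ↭ i ∷ w → shift i (coeff w) n ≡ E⁻ n i
E⁻-coeff i n {w} p with n i in ni≡
... | zero  = ≡.refl
... | suc _ = ≡.trans
  (coeff-↭ (drop-∷ (↭-trans (↭-sym p) (owners-pred i n ni≡))) (updateAt n i pred))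
  (sym (E-coeff (updateAt n i pred)))

-- Recurrences

E⁺-recurrence : ∀ i (n : Vector ℕ S) →
  suc (n i) ℕ.* E⁺ n i ℕ.+ n i ℕ.* E n ≡ ∑ (λ j → n j ℕ.* (δᶜ i j ℕ.* (E n ℕ.+ E⁻ n j)))
E⁺-recurrence i n = begin
  suc (n i) ℕ.* E⁺ n i ℕ.+ n i ℕ.* E n
    ≡⟨ cong₂ (λ a b → suc (n i) ℕ.* a ℕ.+ n i ℕ.* b) (E⁺-coeff i n) (E-coeff n) ⟩
  suc (n i) ℕ.* coeff (i ∷ w) (updateAt n i suc) ℕ.+ n i ℕ.* coeff w n
    ≡⟨ cong₂ ℕ._+_ (coeff-deriv i (i ∷ w) n) (≡.trans (euler i w n) (shift-deriv i i w n)) ⟩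
  δᶜ i i ℕ.* coeff w n ℕ.+ ∑ (λ c → δᶜ i (owner n c) ℕ.* coeff (i ∷ removeAt w c) n)
    ℕ.+ ∑ (λ c → δᶜ i (owner n c) ℕ.* shift i (coeff (removeAt w c)) n)
    -- The added factor σ - x_i does not contain x_i, so its own Leibniz term vanishes.
    ≡⟨ cong (λ a → a ℕ.* coeff w n ℕ.+ ∑ (λ c → δᶜ i (owner n c) ℕ.* coeff (i ∷ removeAt w c) n)
                   ℕ.+ ∑ (λ c → δᶜ i (owner n c) ℕ.* shift i (coeff (removeAt w c)) n)) (δᶜ-irrefl i) ⟩
  ∑ (λ c → δᶜ i (owner n c) ℕ.* coeff (i ∷ removeAt w c) n)
    ℕ.+ ∑ (λ c → δᶜ i (owner n c) ℕ.* shift i (coeff (removeAt w c)) n)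
    ≡⟨ ∑-distrib-+ (λ c → δᶜ i (owner n c) ℕ.* coeff (i ∷ removeAt w c) n)
                   (λ c → δᶜ i (owner n c) ℕ.* shift i (coeff (removeAt w c)) n) ⟨
  ∑ (λ c → δᶜ i (owner n c) ℕ.* coeff (i ∷ removeAt w c) n
           ℕ.+ δᶜ i (owner n c) ℕ.* shift i (coeff (removeAt w c)) n)
    ≡⟨ (sum-cong-≗ λ c → ≡.trans
         (sym (ℕ.*-distribˡ-+ (δᶜ i (owner n c)) (coeff (i ∷ removeAt w c) n) _))
         (cong (δᶜ i (owner n c) ℕ.*_) (exchange c))) ⟩
  ∑ (λ c → δᶜ i (owner n c) ℕ.* (E n ℕ.+ E⁻ n (owner n c)))
    ≡⟨ ∑-owner (λ j → δᶜ i j ℕ.* (E n ℕ.+ E⁻ n j)) n ⟩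
  ∑ (λ j → n j ℕ.* (δᶜ i j ℕ.* (E n ℕ.+ E⁻ n j))) ∎
  where
  open ≡-Reasoning
  w = owners n

  -- Both sides are the coefficient of x^n in σ times the product over the
  -- remaining cards.
  exchange : ∀ c → coeff (i ∷ removeAt w c) n ℕ.+ shift i (coeff (removeAt w c)) n ≡ E n ℕ.+ E⁻ n (owner n c)
  exchange c = begin
    coeff (i ∷ removeAt w c) n ℕ.+ shift i (coeff (removeAt w c)) n
      ≡⟨ coeff-∷-+ i (removeAt w c) n ⟩
    ∑ (λ k → shift k (coeff (removeAt w c)) n)
      ≡⟨ coeff-∷-+ (owner n c) (removeAt w c) n ⟨
    coeff (owner n c ∷ removeAt w c) n ℕ.+ shift (owner n c) (coeff (removeAt w c)) n
      ≡⟨ cong₂ ℕ._+_ (sym (≡.trans (E-coeff n) (coeff-↭ (↭-removeAt w c) n)))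
                     (E⁻-coeff (owner n c) n (↭-removeAt w c)) ⟩
    E n ℕ.+ E⁻ n (owner n c) ∎

E⁺-recurrence-symmetric : ∀ i (n : Vector ℕ S) →
  suc (n i) ℕ.* E⁺ n i ℕ.+ n i ℕ.* E n ℕ.+ n i ℕ.* (E n ℕ.+ E⁻ n i) ≡ ∑ (λ j → n j ℕ.* (E n ℕ.+ E⁻ n j))
E⁺-recurrence-symmetric i n = begin
  suc (n i) ℕ.* E⁺ n i ℕ.+ n i ℕ.* E n ℕ.+ n i ℕ.* (E n ℕ.+ E⁻ n i)
    ≡⟨ cong (ℕ._+ n i ℕ.* (E n ℕ.+ E⁻ n i)) (≡.trans (E⁺-recurrence i n)
         (sum-cong-≗ λ j → x*[y*z]≡y*[x*z] (n j) (δᶜ i j) _)) ⟩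
  ∑ (λ j → δᶜ i j ℕ.* (n j ℕ.* (E n ℕ.+ E⁻ n j))) ℕ.+ n i ℕ.* (E n ℕ.+ E⁻ n i)
    ≡⟨ ∑-δᶜ i (λ j → n j ℕ.* (E n ℕ.+ E⁻ n j)) ⟩
  ∑ (λ j → n j ℕ.* (E n ℕ.+ E⁻ n j)) ∎
  where open ≡-Reasoning

E⁺-recurrence-zero : (n : Vector ℕ (suc S)) →
  suc (n zero) ℕ.* E⁺ n zero ℕ.+ n zero ℕ.* E n ≡
  ∑ (λ j → n (suc j) ℕ.* E⁻ n (suc j)) ℕ.+ ∑ (n ∘ suc) ℕ.* E n
E⁺-recurrence-zero n = begin
  suc (n zero) ℕ.* E⁺ n zero ℕ.+ n zero ℕ.* E n
    ≡⟨ E⁺-recurrence zero n ⟩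
  -- For the first player `δᶜ zero` computes to 0 at `zero` and to 1 at every successor, so the sum
  -- runs over the other players only.
  n zero ℕ.* 0 ℕ.+ ∑ (λ j → n (suc j) ℕ.* (1 ℕ.* (E n ℕ.+ E⁻ n (suc j))))
    ≡⟨ cong₂ ℕ._+_ (ℕ.*-zeroʳ (n zero)) (sum-cong-≗ λ j → distrib (n (suc j)) (E n) (E⁻ n (suc j))) ⟩
  ∑ (λ j → n (suc j) ℕ.* E⁻ n (suc j) ℕ.+ n (suc j) ℕ.* E n)
    ≡⟨ ∑-distrib-+ (λ j → n (suc j) ℕ.* E⁻ n (suc j)) (λ j → n (suc j) ℕ.* E n) ⟩
  ∑ (λ j → n (suc j) ℕ.* E⁻ n (suc j)) ℕ.+ ∑ (λ j → n (suc j) ℕ.* E n)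
    ≡⟨ cong (∑ (λ j → n (suc j) ℕ.* E⁻ n (suc j)) ℕ.+_) (*-distribʳ-sum (E n) (n ∘ suc)) ⟨
  ∑ (λ j → n (suc j) ℕ.* E⁻ n (suc j)) ℕ.+ ∑ (n ∘ suc) ℕ.* E n ∎
  where
  open ≡-Reasoning
  distrib : ∀ a e f → a ℕ.* (1 ℕ.* (e ℕ.+ f)) ≡ a ℕ.* f ℕ.+ a ℕ.* e
  distrib = ℕSolver.solve-∀

-- Passage to the integers

pos-∑ : ∀ {t} (f : Vector ℕ t) → + ∑ f ≡ sum (λ j → + f j)
pos-∑ {zero}  f = ≡.refl
pos-∑ {suc t} f = ≡.trans (ℤ.pos-+ (f zero) _) (cong (_+_ (+ f zero)) (pos-∑ (f ∘ suc)))

pos-suc-* : ∀ a b → + (suc a ℕ.* b) ≡ (+ a + + 1) * + b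
pos-suc-* a b = ≡.trans (ℤ.pos-* (suc a) b) (cong (_* + b) (ℤ.+-comm (+ 1) (+ a)))

-- On each side the multiple of `e` occurs twice, once from n_i E and once from the summand j = i
-- that was added; hence the factor 2. Adding the difference of the two equal sides, which is 0,
-- reduces the claim to a ring identity.
difference : ∀ (a b e p q p′ q′ : ℕ) →
  suc a ℕ.* p ℕ.+ a ℕ.* e ℕ.+ a ℕ.* (e ℕ.+ q) ≡ suc b ℕ.* p′ ℕ.+ b ℕ.* e ℕ.+ b ℕ.* (e ℕ.+ q′) →
  + 2 * (+ b - + a) * + e ≡ (+ a + + 1) * + p + + a * + q - (+ b + + 1) * + p′ - + b * + q′
difference a b e p q p′ q′ eq = begin
  + 2 * (+ b - + a) * + e
    ≡⟨ ℤ.+-identityʳ _ ⟨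
  + 2 * (+ b - + a) * + e + + 0
    ≡⟨ cong (_+_ (+ 2 * (+ b - + a) * + e))
         (ℤ.i≡j⇒i-j≡0 (≡.trans (sym (cast a p q)) (≡.trans (cong +_ eq) (cast b p′ q′)))) ⟨
  + 2 * (+ b - + a) * + e + (side (+ a) (+ e) (+ p) (+ q) - side (+ b) (+ e) (+ p′) (+ q′))
    ≡⟨ regroup (+ a) (+ b) (+ e) (+ p) (+ q) (+ p′) (+ q′) ⟩
  (+ a + + 1) * + p + + a * + q - (+ b + + 1) * + p′ - + b * + q′ ∎
  where
  open ≡-Reasoning
  side : ℤ → ℤ → ℤ → ℤ → ℤ
  side a e p q = (a + + 1) * p + a * e + a * (e + q)

  cast : ∀ a p q → + (suc a ℕ.* p ℕ.+ a ℕ.* e ℕ.+ a ℕ.* (e ℕ.+ q)) ≡ side (+ a) (+ e) (+ p) (+ q)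
  -- Sums of nonnegative integers compute under `+_`, so only the products need a lemma.
  cast a p q = cong₂ _+_ (cong₂ _+_ (pos-suc-* a p) (ℤ.pos-* a e)) (ℤ.pos-* a (e ℕ.+ q))

  regroup : ∀ a b e p q p′ q′ →
    + 2 * (b - a) * e + (((a + + 1) * p + a * e + a * (e + q)) - ((b + + 1) * p′ + b * e + b * (e + q′)))
    ≡ (a + + 1) * p + a * q - (b + + 1) * p′ - b * q′
  regroup = ℤSolver.solve-∀

transpose : ∀ (a e p y s : ℕ) → suc a ℕ.* p ℕ.+ a ℕ.* e ≡ y ℕ.+ s ℕ.* e →
            (+ a + + 1) * + p ≡ + y + (+ s - + a) * + e
transpose a e p y s eq = begin
  (+ a + + 1) * + p
    ≡⟨ cancel ((+ a + + 1) * + p) (+ a) (+ e) ⟨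
  ((+ a + + 1) * + p + + a * + e) - + a * + e
    ≡⟨ cong (_- + a * + e) (cong₂ _+_ (pos-suc-* a p) (ℤ.pos-* a e)) ⟨
  + (suc a ℕ.* p ℕ.+ a ℕ.* e) - + a * + e
    ≡⟨ cong (λ t → + t - + a * + e) eq ⟩
  + (y ℕ.+ s ℕ.* e) - + a * + e
    ≡⟨ cong (λ t → + y + t - + a * + e) (ℤ.pos-* s e) ⟩
  (+ y + + s * + e) - + a * + e
    ≡⟨ collect (+ y) (+ s) (+ a) (+ e) ⟩
  + y + (+ s - + a) * + e ∎
  where
  open ≡-Reasoning
  cancel : ∀ x b e → (x + b * e) - b * e ≡ x
  cancel = ℤSolver.solve-∀

  collect : ∀ y s b e → (y + s * e) - b * e ≡ y + (s - b) * e
  collect = ℤSolver.solve-∀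

mainTheorem8 :
    ∀ {k : ℕ} (n : Vector ℕ (3 ℕ.+ k)) →
    let 1st = zero
        2nd = suc zero
        n₁ = + n 1st
        n₂ = + n 2nd
    in
    (+ 2 * (n₂ - n₁) * + E n
      ≡ (n₁ + + 1) * + E⁺ n 1st + n₁ * + E⁻ n 1st - (n₂ + + 1) * + E⁺ n 2nd - n₂ * + E⁻ n 2nd)
    ×
    ((n₁ + + 1) * + E⁺ n 1st
      ≡ sum (λ (j : Fin (2 ℕ.+ k)) → + n (suc j) * + E⁻ n (suc j))
        + (sum (λ (j : Fin (2 ℕ.+ k)) → + n (suc j)) - n₁) * + E n)
mainTheorem8 {k} n = first , second
  where
  1st 2nd : Fin (3 ℕ.+ k)
  1st = zero
  2nd = suc zero

  first : + 2 * (+ n 2nd - + n 1st) * + E n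
          ≡ (+ n 1st + + 1) * + E⁺ n 1st + + n 1st * + E⁻ n 1st - (+ n 2nd + + 1) * + E⁺ n 2nd - + n 2nd * + E⁻ n 2nd
  first = difference (n 1st) (n 2nd) (E n) (E⁺ n 1st) (E⁻ n 1st) (E⁺ n 2nd) (E⁻ n 2nd)
    -- The symmetric recurrences of both players share their right side.
    (≡.trans (E⁺-recurrence-symmetric 1st n) (sym (E⁺-recurrence-symmetric 2nd n)))

  second : (+ n 1st + + 1) * + E⁺ n 1st
           ≡ sum (λ j → + n (suc j) * + E⁻ n (suc j)) + (sum (λ j → + n (suc j)) - + n 1st) * + E n
  second = ≡.trans
    (transpose (n 1st) (E n) (E⁺ n 1st) (∑ (λ j → n (suc j) ℕ.* E⁻ n (suc j))) (∑ (n ∘ suc)) (E⁺-recurrence-zero n))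
    -- The two sums were formed in `ℕ`; the cast is now moved inside them.
    (cong₂ (λ y s → y + (s - + n 1st) * + E n)
      (≡.trans (pos-∑ (λ j → n (suc j) ℕ.* E⁻ n (suc j)))
               (ℤSum.sum-cong-≗ λ j → ℤ.pos-* (n (suc j)) (E⁻ n (suc j))))
      (pos-∑ (n ∘ suc)))
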